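{- Let $n\ge2$. Let $A_1=\{1\text{ - }23\}$, $A_2=\{2\text{ - }13,21\text{ - }3\}$, $A_3=\{2\text{ - }31,23\text{ - }1\}$, $A_4=\{1\text{ - }32,13\text{ - }2\}$. For every choice of $p_i\in A_i$ ($i=1,2,3,4$), $|S_n(p_1,p_2,p_3,p_4)|=2$ and $$S_n(p_1,p_2,p_3,p_4)=\{\,n\,(n-1)\ldots 3\,2\,1,\ \ n\,(n-1)\ldots 3\,1\,2\,\}.$$
   Context: $S_n$ is the set of permutations $\pi=\pi_1\pi_2\cdots\pi_n$ of $\{1,\dots,n\}$ (written in one-line notation). For $abc$ a permutation of $123$, the generalized pattern $a\text{ - }bc$ is contained in $\pi$ if there are indices $i<j$ with $j+1\le n$ such that $\pi_i\pi_j\pi_{j+1}$ is order-isomorphic to $abc$; the generalized pattern $ab\text{ - }c$ is contained in $\pi$ if there are indices $i,k$ with $i+1<k\le n$ such that $\pi_i\pi_{i+1}\pi_k$ is order-isomorphic to $abc$. $\pi$ avoids a pattern if it does not contain it. $S_n(p_1,\dots,p_m)$ is the set of $\pi\in S_n$ avoiding all of $p_1,\dots,p_m$. -}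

module Defs where

open import Data.Fin using (Fin; toℕ)
open import Data.List using (List; []; _∷_; _++_; map; upTo; downFrom; length; lookup)
open import Data.List.Membership.Propositional using (_∈_)
open import Data.List.Relation.Binary.Permutation.Propositional using (_↭_)
open import Data.List.Relation.Unary.All using (All)
open import Data.List.Relation.Unary.Unique.Propositional using (Unique)
open import Data.Nat using (ℕ; suc; _+_; _∸_; _<_)
open import Data.Product using (_×_; ∃-syntax)
open import Data.Vec as Vec using (Vec; []; _∷_)
open import Function.Bundles using (_⇔_)
open import Relation.Binary.PropositionalEquality using (_≡_)
open import Relation.Nullary using (¬_)
open import Relation.Unary using (Pred; _≐_)
open import Level using (0ℓ)

-- Permutations are words in one-line notation.
Word : Set
Word = List ℕ

IsPermutation : ℕ → Pred Word 0ℓ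
IsPermutation n π = π ↭ map suc (upTo n)

OrderIsomorphic : ∀ {k} → Vec ℕ k → Vec ℕ k → Set
OrderIsomorphic {k} u v =
  ∀ (i j : Fin k) →
    (Vec.lookup u i < Vec.lookup u j) ⇔ (Vec.lookup v i < Vec.lookup v j)

-- The pattern a-bc is written  a - b · c  and ab-c is written  a · b - c ;
-- letters joined by · must occupy adjacent positions.
data Pattern : Set where
  _-_·_ : (a b c : ℕ) → Pattern
  _·_-_ : (a b c : ℕ) → Pattern

Contains : Word → Pattern → Set
Contains π (a - b · c) =
  ∃[ i ] ∃[ j ] ∃[ j⁺ ]
    (toℕ i < toℕ j) × (toℕ j⁺ ≡ suc (toℕ j)) ×
    OrderIsomorphic (lookup π i ∷ lookup π j ∷ lookup π j⁺ ∷ []) (a ∷ b ∷ c ∷ [])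
Contains π (a · b - c) =
  ∃[ i ] ∃[ i⁺ ] ∃[ k ]
    (toℕ i⁺ ≡ suc (toℕ i)) × (toℕ i⁺ < toℕ k) ×
    OrderIsomorphic (lookup π i ∷ lookup π i⁺ ∷ lookup π k ∷ []) (a ∷ b ∷ c ∷ [])

Avoids : Word → Pattern → Set
Avoids π p = ¬ Contains π p

S : ℕ → List Pattern → Pred Word 0ℓ
S n ps π = IsPermutation n π × All (Avoids π) ps

HasCardinality : {A : Set} → Pred A 0ℓ → ℕ → Set
HasCardinality P k = ∃[ xs ] Unique xs × (length xs ≡ k) × (P ≐ (_∈ xs))

A₁ A₂ A₃ A₄ : List Pattern
A₁ = (1 - 2 · 3) ∷ []
A₂ = (2 - 1 · 3) ∷ (2 · 1 - 3) ∷ []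
A₃ = (2 - 3 · 1) ∷ (2 · 3 - 1) ∷ []
A₄ = (1 - 3 · 2) ∷ (1 · 3 - 2) ∷ []

-- n (n-1) … 3 2 1   (downFrom n lists n-1, …, 1, 0)
decreasing : ℕ → Word
decreasing n = map suc (downFrom n)

-- n (n-1) … 3 1 2 , meaningful for n ≥ 2
decreasing-12 : ℕ → Word
decreasing-12 n = map (3 +_) (downFrom (n ∸ 2)) ++ 1 ∷ 2 ∷ []

{-# OPTIONS --safe #-}
-- A dashed pattern is in particular contained as soon as three consecutive
-- letters form it.  Hence in an avoiding permutation the first of any three consecutive letters is
-- the largest, so each letter followed by at least two others exceeds everything after it: the word
-- is n, n-1, …, 3 followed by 21 or 12.  Conversely, in each of the four patterns the first letter
-- is not the largest, so such words avoid them.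
module Submission where

open import Defs
open import Data.List using (List; []; _∷_)
open import Data.List.Membership.Propositional using (_∈_)
open import Data.Nat using (ℕ; _≤_)
open import Data.Product using (_×_)
open import Relation.Unary using (_≐_)

open import Data.Fin using (Fin; zero; suc; toℕ)
open import Data.List using (length; lookup; upTo)
open import Data.List.Membership.Propositional.Properties using (∈-lookup)
open import Data.List.Properties using (∷-injectiveʳ; reverse-upTo)
open import Data.List.Relation.Binary.Permutation.Propositional
  using (_↭_; prep; swap; ↭-refl; ↭-sym; ↭-trans; ↭⇒↭ₛ)
open import Data.List.Relation.Binary.Permutation.Propositional.Properties
  using (∈-resp-↭; All-resp-↭; drop-∷; ↭-length; ↭-reverse; ↭-singleton-inv) renaming (map⁺ to ↭-map⁺)
import Data.List.Relation.Binary.Permutation.Setoid.Properties as ↭ₛ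
open import Data.List.Relation.Unary.All as All using (All; []; _∷_)
open import Data.List.Relation.Unary.Any using (here; there)
open import Data.List.Relation.Unary.Unique.Propositional using (Unique; []; _∷_)
import Data.List.Relation.Unary.Unique.Propositional.Properties as Unique
open import Data.Nat using (zero; suc; _+_; _<_; z≤n; s≤s; s<s⁻¹)
open import Data.Nat.Properties
  using (<-trans; <-irrefl; <-asym; <-cmp; ≤-antisym; ≤-refl; ≤-reflexive; <⇒≤; n<1+n; m<n⇒m<1+n;
         m≤n⇒m≤1+n; suc-injective)
open import Data.Product using (∃-syntax; _,_)
open import Data.Vec as Vec using (Vec; []; _∷_)
open import Data.Vec.Properties using (lookup-map)
import Data.Vec.Relation.Unary.All as VecAll
open import Data.Vec.Relation.Unary.All.Properties using (lookup⁺)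
open import Data.Vec.Relation.Unary.AllPairs using (AllPairs; []; _∷_)
open import Function.Bundles using (mk⇔; module Equivalence)
open import Relation.Binary.Definitions using (tri<; tri≈; tri>)
open import Relation.Binary.PropositionalEquality
  using (_≡_; _≢_; refl; sym; cong; subst)
open import Relation.Binary.PropositionalEquality.Properties using (setoid)
open import Relation.Nullary using (¬_; contradiction)

-- In a strictly increasing vector, comparing entries amounts to comparing positions, and the
-- positions are the same for `u` and `v`.
increasing⇒orderIsomorphic : ∀ {k} {u v : Vec ℕ k} →
  AllPairs _<_ u → AllPairs _<_ v → OrderIsomorphic u v
increasing⇒orderIsomorphic (u₀< ∷ _) (v₀< ∷ _) zero zero =
  mk⇔ (λ lt → contradiction lt (<-irrefl refl)) (λ lt → contradiction lt (<-irrefl refl))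
increasing⇒orderIsomorphic (u₀< ∷ _) (v₀< ∷ _) zero (suc j) =
  mk⇔ (λ _ → lookup⁺ v₀< j) (λ _ → lookup⁺ u₀< j)
increasing⇒orderIsomorphic (u₀< ∷ _) (v₀< ∷ _) (suc i) zero =
  mk⇔ (λ lt → contradiction lt (<-asym (lookup⁺ u₀< i)))
      (λ lt → contradiction lt (<-asym (lookup⁺ v₀< i)))
increasing⇒orderIsomorphic (_ ∷ u↗) (_ ∷ v↗) (suc i) (suc j) =
  increasing⇒orderIsomorphic u↗ v↗ i j

orderIsomorphic-reindex : ∀ {k l} {u v : Vec ℕ k} → OrderIsomorphic u v → (σ : Vec (Fin k) l) →
  OrderIsomorphic (Vec.map (Vec.lookup u) σ) (Vec.map (Vec.lookup v) σ)
orderIsomorphic-reindex {u = u} {v} u≈v σ i j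
  rewrite lookup-map i (Vec.lookup u) σ | lookup-map j (Vec.lookup u) σ
        | lookup-map i (Vec.lookup v) σ | lookup-map j (Vec.lookup v) σ
  = u≈v (Vec.lookup σ i) (Vec.lookup σ j)

increasing₃ : ∀ {x y z} → x < y → y < z → AllPairs _<_ (x ∷ y ∷ z ∷ [])
increasing₃ x<y y<z = (x<y ∷ <-trans x<y y<z ∷ []) ∷ (y<z ∷ []) ∷ [] ∷ []
  where open VecAll using ([]; _∷_)

-- Here `σ` lists the zero-based ranks of the letters in word order. For a concrete `σ` both sides
-- compute, to the three letters and to the pattern they form.
arrangement : ∀ {x y z} → x < y → y < z → (σ : Vec (Fin 3) 3) →
  OrderIsomorphic (Vec.map (Vec.lookup (x ∷ y ∷ z ∷ [])) σ)
                  (Vec.map (Vec.lookup (1 ∷ 2 ∷ 3 ∷ [])) σ)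
arrangement {x} {y} {z} x<y y<z = orderIsomorphic-reindex {u = x ∷ y ∷ z ∷ []} {1 ∷ 2 ∷ 3 ∷ []}
  (increasing⇒orderIsomorphic (increasing₃ x<y y<z) (increasing₃ (n<1+n 1) (n<1+n 2)))

-- Forgets the dash, so that both choices in each of `A₂`, `A₃`, `A₄` are handled at once.
letters : Pattern → Vec ℕ 3
letters (a - b · c) = a ∷ b ∷ c ∷ []
letters (a · b - c) = a ∷ b ∷ c ∷ []

letters-A₁ : All (λ p → letters p ≡ 1 ∷ 2 ∷ 3 ∷ []) A₁
letters-A₁ = refl ∷ []

letters-A₂ : All (λ p → letters p ≡ 2 ∷ 1 ∷ 3 ∷ []) A₂
letters-A₂ = refl ∷ refl ∷ []

letters-A₃ : All (λ p → letters p ≡ 2 ∷ 3 ∷ 1 ∷ []) A₃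
letters-A₃ = refl ∷ refl ∷ []

letters-A₄ : All (λ p → letters p ≡ 1 ∷ 3 ∷ 2 ∷ []) A₄
letters-A₄ = refl ∷ refl ∷ []

-- Three consecutive positions satisfy the adjacency condition wherever the dash stands.
contains-head : ∀ {x y z π u} p → letters p ≡ u → OrderIsomorphic (x ∷ y ∷ z ∷ []) u →
  Contains (x ∷ y ∷ z ∷ π) p
contains-head (a - b · c) refl iso = zero , suc zero , suc (suc zero) , n<1+n 0 , refl , iso
contains-head (a · b - c) refl iso = zero , suc zero , suc (suc zero) , refl , n<1+n 1 , iso

contains-tail : ∀ {x π} p → Contains π p → Contains (x ∷ π) p
contains-tail (a - b · c) (i , j , j⁺ , i<j , j⁺≡ , iso) =
  suc i , suc j , suc j⁺ , s≤s i<j , cong suc j⁺≡ , iso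
contains-tail (a · b - c) (i , i⁺ , k , i⁺≡ , i⁺<k , iso) =
  suc i , suc i⁺ , suc k , cong suc i⁺≡ , s≤s i⁺<k , iso

-- Adjacency is weakened to order of positions, which is all that the avoidance direction uses.
contains⇒subword : ∀ {π} p → Contains π p → ∃[ i ] ∃[ j ] ∃[ k ]
  (toℕ i < toℕ j) × (toℕ j < toℕ k) ×
  OrderIsomorphic (lookup π i ∷ lookup π j ∷ lookup π k ∷ []) (letters p)
contains⇒subword (a - b · c) (i , j , j⁺ , i<j , j⁺≡ , iso) =
  i , j , j⁺ , i<j , ≤-reflexive (sym j⁺≡) , iso
contains⇒subword (a · b - c) (i , i⁺ , k , i⁺≡ , i⁺<k , iso) =
  i , i⁺ , k , ≤-reflexive (sym i⁺≡) , i⁺<k , iso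

-- The last two letters are left uncompared: this freedom yields exactly the two endings 21 and 12.
data Dominating : Word → Set where
  pair : ∀ x y → Dominating (x ∷ y ∷ [])
  cons : ∀ {x y z π} → All (_< x) (y ∷ z ∷ π) → Dominating (y ∷ z ∷ π) →
         Dominating (x ∷ y ∷ z ∷ π)

-- A position with two later ones is not among the last two, so a `cons` governs its letter.
dominating-lookup : ∀ {π} → Dominating π → ∀ i j k → toℕ i < toℕ j → toℕ j < toℕ k →
  lookup π j < lookup π i × lookup π k < lookup π i
dominating-lookup (pair x y) zero (suc zero) (suc zero) _ (s≤s ())
dominating-lookup (pair x y) (suc zero) (suc zero) _ (s≤s ()) _
dominating-lookup (cons π<x _) zero (suc j) (suc k) _ _ =
  All.lookup π<x (∈-lookup j) , All.lookup π<x (∈-lookup k)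
dominating-lookup (cons _ d) (suc i) (suc j) (suc k) i<j j<k =
  dominating-lookup d i j k (s<s⁻¹ i<j) (s<s⁻¹ j<k)

-- An occurrence would carry the larger pattern letter at `r` to a letter of the word exceeding an
-- earlier one that dominates it.
dominating⇒avoids : ∀ {π} → Dominating π → ∀ {u} p → letters p ≡ u →
  ∃[ r ] Vec.lookup u zero < Vec.lookup u r → Avoids π p
dominating⇒avoids d p refl (r , p₀<pᵣ) c
  with i , j , k , i<j , j<k , iso ← contains⇒subword p c
  with πⱼ<πᵢ , πₖ<πᵢ ← dominating-lookup d i j k i<j j<k
  = impossible r (Equivalence.from (iso zero r) p₀<pᵣ)
  where
  impossible : ∀ r → ¬ (_ < Vec.lookup (_ ∷ _ ∷ _ ∷ []) r)
  impossible zero             = <-irrefl refl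
  impossible (suc zero)       = <-asym πⱼ<πᵢ
  impossible (suc (suc zero)) = <-asym πₖ<πᵢ

-- The four patterns are exactly the arrangements of 123 that do not begin with 3, so distinct
-- letters `x`, `y`, `z` can only form 312 or 321.
avoids⇒first-largest : ∀ {x y z π} {p₁ p₂ p₃ p₄} →
  letters p₁ ≡ 1 ∷ 2 ∷ 3 ∷ [] → letters p₂ ≡ 2 ∷ 1 ∷ 3 ∷ [] →
  letters p₃ ≡ 2 ∷ 3 ∷ 1 ∷ [] → letters p₄ ≡ 1 ∷ 3 ∷ 2 ∷ [] →
  Unique (x ∷ y ∷ z ∷ π) → All (Avoids (x ∷ y ∷ z ∷ π)) (p₁ ∷ p₂ ∷ p₃ ∷ p₄ ∷ []) →
  y < x × z < x
avoids⇒first-largest {x} {y} {z} {π} {p₁} {p₂} {p₃} {p₄} e₁ e₂ e₃ e₄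
  ((x≢y ∷ x≢z ∷ _) ∷ (y≢z ∷ _) ∷ _) (av₁ ∷ av₂ ∷ av₃ ∷ av₄ ∷ [])
  with <-cmp x y | <-cmp x z | <-cmp y z
... | tri≈ _ x≡y _ | _            | _            = contradiction x≡y x≢y
... | _            | tri≈ _ x≡z _ | _            = contradiction x≡z x≢z
... | _            | _            | tri≈ _ y≡z _ = contradiction y≡z y≢z
... | tri> _ _ y<x | tri> _ _ z<x | _            = y<x , z<x
... | tri> _ _ y<x | tri< x<z _ _ | _            =
  contradiction (contains-head p₂ e₂ (arrangement y<x x<z (suc zero ∷ zero ∷ suc (suc zero) ∷ []))) av₂
... | tri< x<y _ _ | _            | tri< y<z _ _ =
  contradiction (contains-head p₁ e₁ (arrangement x<y y<z (zero ∷ suc zero ∷ suc (suc zero) ∷ []))) av₁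
... | tri< x<y _ _ | tri< x<z _ _ | tri> _ _ z<y =
  contradiction (contains-head p₄ e₄ (arrangement x<z z<y (zero ∷ suc (suc zero) ∷ suc zero ∷ []))) av₄
... | tri< x<y _ _ | tri> _ _ z<x | tri> _ _ z<y =
  contradiction (contains-head p₃ e₃ (arrangement z<x x<y (suc zero ∷ suc (suc zero) ∷ zero ∷ []))) av₃

avoids⇒dominating : ∀ {p₁ p₂ p₃ p₄} →
  letters p₁ ≡ 1 ∷ 2 ∷ 3 ∷ [] → letters p₂ ≡ 2 ∷ 1 ∷ 3 ∷ [] →
  letters p₃ ≡ 2 ∷ 3 ∷ 1 ∷ [] → letters p₄ ≡ 1 ∷ 3 ∷ 2 ∷ [] →
  ∀ {π} → 2 ≤ length π → Unique π → All (Avoids π) (p₁ ∷ p₂ ∷ p₃ ∷ p₄ ∷ []) → Dominating π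
avoids⇒dominating e₁ e₂ e₃ e₄ {_ ∷ []} (s≤s ()) _ _
avoids⇒dominating e₁ e₂ e₃ e₄ {x ∷ y ∷ []} _ _ _ = pair x y
avoids⇒dominating e₁ e₂ e₃ e₄ {x ∷ y ∷ z ∷ π} _ u@(_ ∷ u′) av
  with y<x , z<x ← avoids⇒first-largest e₁ e₂ e₃ e₄ u av
  with avoids⇒dominating e₁ e₂ e₃ e₄ {y ∷ z ∷ π} (s≤s (s≤s z≤n)) u′
         (All.map (λ {p} av c → av (contains-tail p c)) av)
-- In a final pair `y` and `z` may come in either order, so `z<x` is needed; in a longer tail `y`
-- dominates the rest and transitivity suffices.
... | pair _ _          = cons (y<x ∷ z<x ∷ []) (pair y z)
... | d@(cons rest<y _) = cons (y<x ∷ All.map (λ lt → <-trans lt y<x) rest<y) d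

isPermutation-decreasing : ∀ n → IsPermutation n (decreasing n)
isPermutation-decreasing n =
  ↭-map⁺ suc (subst (_↭ upTo n) (reverse-upTo n) (↭-reverse (upTo n)))

isPermutation⇒unique : ∀ {n π} → IsPermutation n π → Unique π
isPermutation⇒unique {n} π↭ =
  ↭ₛ.Unique-resp-↭ (setoid ℕ) (↭⇒↭ₛ (↭-sym π↭)) (Unique.map⁺ suc-injective (Unique.upTo⁺ n))

decreasing-≤ : ∀ n → All (_≤ n) (decreasing n)
decreasing-≤ zero    = []
decreasing-≤ (suc n) = ≤-refl ∷ All.map m≤n⇒m≤1+n (decreasing-≤ n)

dominating-decreasing : ∀ k → Dominating (decreasing (2 + k))
dominating-decreasing zero    = pair 2 1
dominating-decreasing (suc k) = cons (All.map s≤s (decreasing-≤ (2 + k))) (dominating-decreasing k)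

decreasing-12-↭ : ∀ k → decreasing-12 (2 + k) ↭ decreasing (2 + k)
decreasing-12-↭ zero    = swap 1 2 ↭-refl
decreasing-12-↭ (suc k) = prep (3 + k) (decreasing-12-↭ k)

-- Matching on the derivation exposes the two leading letters that `cons` requires;
-- `decreasing-12 (2 + k)` does not compute to such a form for a variable `k`.
dominating-∷ : ∀ {x π} → All (_< x) π → Dominating π → Dominating (x ∷ π)
dominating-∷ π<x d@(pair _ _) = cons π<x d
dominating-∷ π<x d@(cons _ _) = cons π<x d

dominating-decreasing-12 : ∀ k → Dominating (decreasing-12 (2 + k))
dominating-decreasing-12 zero    = pair 1 2
dominating-decreasing-12 (suc k) = dominating-∷
  (All-resp-↭ (↭-sym (decreasing-12-↭ k)) (All.map s≤s (decreasing-≤ (2 + k))))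
  (dominating-decreasing-12 k)

decreasing≢decreasing-12 : ∀ k → decreasing (2 + k) ≢ decreasing-12 (2 + k)
decreasing≢decreasing-12 zero    ()
decreasing≢decreasing-12 (suc k) eq = decreasing≢decreasing-12 k (∷-injectiveʳ eq)

-- No letter exceeds `suc n`, while `suc n` itself occurs in the word and is therefore at most the
-- dominating `x`.
dominating-head : ∀ {n x y z π} → Dominating (x ∷ y ∷ z ∷ π) →
  (x ∷ y ∷ z ∷ π) ↭ decreasing (suc n) → x ≡ suc n
dominating-head {n} (cons π<x _) π↭ =
  ≤-antisym (All.lookup (decreasing-≤ (suc n)) (∈-resp-↭ π↭ (here refl)))
            (All.lookup (≤-refl ∷ All.map <⇒≤ π<x) (∈-resp-↭ (↭-sym π↭) (here refl)))

∈-tails : ∀ {x} {π ρ σ : Word} → π ∈ ρ ∷ σ ∷ [] → (x ∷ π) ∈ (x ∷ ρ) ∷ (x ∷ σ) ∷ []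
∈-tails (here refl)         = here refl
∈-tails (there (here refl)) = there (here refl)

-- Induction on `k`: the forced head is the common first letter of both target words, and removing
-- it leaves the same problem one size smaller.
dominating-permutation : ∀ k {π} → Dominating π → π ↭ decreasing (2 + k) →
  π ∈ decreasing (2 + k) ∷ decreasing-12 (2 + k) ∷ []
dominating-permutation zero (pair x y) π↭ with ∈-resp-↭ π↭ (here refl)
... | here refl with refl ← ↭-singleton-inv (drop-∷ π↭) = here refl
-- The word starts with 1, so 21 is first swapped to 12 to give both sides the same head to cancel.
... | there (here refl)
  with refl ← ↭-singleton-inv (drop-∷ (↭-trans π↭ (swap 2 1 ↭-refl))) = there (here refl)
dominating-permutation zero    (cons _ _) π↭ with () ← ↭-length π↭
dominating-permutation (suc k) (pair _ _) π↭ with () ← ↭-length π↭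
dominating-permutation (suc k) d@(cons _ d′) π↭ with refl ← dominating-head d π↭ =
  ∈-tails (dominating-permutation k d′ (drop-∷ π↭))

proposition2p10 : ∀ (n : ℕ) → 2 ≤ n →
    ∀ (p₁ p₂ p₃ p₄ : Pattern) → p₁ ∈ A₁ → p₂ ∈ A₂ → p₃ ∈ A₃ → p₄ ∈ A₄ →
    HasCardinality (S n (p₁ ∷ p₂ ∷ p₃ ∷ p₄ ∷ [])) 2 ×
    (S n (p₁ ∷ p₂ ∷ p₃ ∷ p₄ ∷ []) ≐ (_∈ decreasing n ∷ decreasing-12 n ∷ []))
proposition2p10 (suc zero) (s≤s ())
proposition2p10 (suc (suc k)) _ p₁ p₂ p₃ p₄ p₁∈ p₂∈ p₃∈ p₄∈ =
  (_ , (decreasing≢decreasing-12 k ∷ []) ∷ [] ∷ [] , refl , S≐) , S≐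
  where
  ps = p₁ ∷ p₂ ∷ p₃ ∷ p₄ ∷ []
  e₁ = All.lookup letters-A₁ p₁∈
  e₂ = All.lookup letters-A₂ p₂∈
  e₃ = All.lookup letters-A₃ p₃∈
  e₄ = All.lookup letters-A₄ p₄∈

  dominating⇒S : ∀ {π} → Dominating π → π ↭ decreasing (2 + k) → S (2 + k) ps π
  dominating⇒S d π↭ =
    ↭-trans π↭ (isPermutation-decreasing (2 + k)) ,
    -- Each witness is a zero-based position where the pattern exceeds its first letter: 1 in 123, 2
    -- in 213, 1 in 231, 1 in 132.
    dominating⇒avoids d p₁ e₁ (suc zero , n<1+n 1) ∷
    dominating⇒avoids d p₂ e₂ (suc (suc zero) , n<1+n 2) ∷
    dominating⇒avoids d p₃ e₃ (suc zero , n<1+n 2) ∷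
    dominating⇒avoids d p₄ e₄ (suc zero , m<n⇒m<1+n (n<1+n 1)) ∷ []

  S⇒∈ : ∀ {π} → S (2 + k) ps π → π ∈ decreasing (2 + k) ∷ decreasing-12 (2 + k) ∷ []
  S⇒∈ (π-perm , av) = dominating-permutation k
    (avoids⇒dominating e₁ e₂ e₃ e₄ 2≤∣π∣ (isPermutation⇒unique π-perm) av) π↭
    where
    π↭    = ↭-trans π-perm (↭-sym (isPermutation-decreasing (2 + k)))
    2≤∣π∣ = subst (2 ≤_) (sym (↭-length π↭)) (s≤s (s≤s z≤n))

  ∈⇒S : ∀ {π} → π ∈ decreasing (2 + k) ∷ decreasing-12 (2 + k) ∷ [] → S (2 + k) ps π
  ∈⇒S (here refl)         = dominating⇒S (dominating-decreasing k) ↭-refl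
  ∈⇒S (there (here refl)) = dominating⇒S (dominating-decreasing-12 k) (decreasing-12-↭ k)

  S≐ : S (2 + k) ps ≐ (_∈ decreasing (2 + k) ∷ decreasing-12 (2 + k) ∷ [])
  S≐ = S⇒∈ , ∈⇒S
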